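{- If $T$ is a tree of order $n\ge 3$, then $\iota_{\rm g}(T)\le \frac{5}{11}n$.
   Context: For a graph $G$ and $X\subseteq V(G)$, $N_G[X]$ denotes the set of vertices in $X$ or adjacent to a vertex of $X$. The isolation game on a finite graph $G$ is played by two players, Dominator and Staller, who alternately select vertices of $G$. If $X$ is the set of vertices selected so far, a vertex $x$ may be selected (is playable) only if $x$ dominates (i.e., equals or is adjacent to) some vertex belonging to a component of $G - N_G[X]$ with at least two vertices. The game ends when no playable vertex exists. Dominator aims to minimize the total number of selected vertices, Staller aims to maximize it. The game isolation number $\iota_{\rm g}(G)$ is the number of vertices selected when Dominator makes the first move and both play optimally. -}

module Defs where

open import Data.Nat using (ℕ; zero; suc; _⊓_; _⊔_; _≥_)
open import Data.Bool using (Bool; true; false; not; _∧_; _∨_)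
open import Data.Fin using (Fin; _≟_)
open import Data.Fin.Subset using (Subset; ⊥; ∣_∣; inside)
open import Data.Vec using (lookup; _[_]≔_)
open import Data.Bool.ListAction using (any)
open import Data.List using (List; []; _∷_; [_]; _++_; filter; map; foldr; length; allFin)
open import Data.List.Relation.Unary.Unique.Propositional using (Unique)
open import Data.List.Relation.Unary.Linked using (Linked)
open import Data.Product using (Σ; ∃; _×_)
open import Relation.Nullary using (¬_)
open import Relation.Nullary.Decidable using (⌊_⌋)
open import Relation.Binary.PropositionalEquality using (_≡_)
open import Relation.Binary.Construct.Closure.ReflexiveTransitive using (Star)

record Graph (n : ℕ) : Set where
  field
    adj   : Fin n → Fin n → Bool
    sym   : ∀ u v → adj u v ≡ adj v u
    irrefl : ∀ v → adj v v ≡ false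

module _ {n : ℕ} (G : Graph n) where
  open Graph G

  Adj : Fin n → Fin n → Set
  Adj u v = adj u v ≡ true

  Connected : Set
  Connected = ∀ u v → Star Adj u v

  HasCycle : Set
  HasCycle = ∃ λ (v : Fin n) → ∃ λ (ws : List (Fin n)) →
    length ws ≥ 2 × Unique (v ∷ ws) × Linked Adj (v ∷ ws ++ [ v ])

  IsTree : Set
  IsTree = Connected × ¬ HasCycle

  vertices : List (Fin n)
  vertices = allFin n

  inClosedNbhd : Subset n → Fin n → Bool
  inClosedNbhd X v = any (λ u → lookup X u ∧ (⌊ u ≟ v ⌋ ∨ adj u v)) vertices

  -- v is a vertex of G - N_G[X] lying in a component with at least two
  -- vertices, i.e. v ∉ N_G[X] and v has a neighbour u ∉ N_G[X].
  inNontrivialComponent : Subset n → Fin n → Bool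
  inNontrivialComponent X v =
    not (inClosedNbhd X v) ∧ any (λ u → adj v u ∧ not (inClosedNbhd X u)) vertices

  playable : Subset n → Fin n → Bool
  playable X x = any (λ v → (⌊ x ≟ v ⌋ ∨ adj x v) ∧ inNontrivialComponent X v) vertices

  playableMoves : Subset n → List (Fin n)
  playableMoves X = filter (λ x → playable X x ≡? true) vertices
    where
      open import Data.Bool.Properties using () renaming (_≟_ to _≡?_)

  -- Minimax value of the game from position X with the given player to move
  -- (true = Dominator, minimising; false = Staller, maximising).  The fuel
  -- argument bounds the remaining number of moves; since a selected vertex is
  -- never playable again, fuel n suffices to play the game to its end.
  gameValue : ℕ → Bool → Subset n → ℕ
  gameValue zero    _    X = ∣ X ∣
  gameValue (suc f) turn X with playableMoves X
  ... | []     = ∣ X ∣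
  ... | x ∷ xs = combine turn (map next xs)
    where
      next : Fin n → ℕ
      next y = gameValue f (not turn) (X [ y ]≔ inside)
      combine : Bool → List ℕ → ℕ
      combine true  ys = foldr _⊓_ (next x) ys
      combine false ys = foldr _⊔_ (next x) ys

  ιg : ℕ
  ιg = gameValue n true ⊥

{-# OPTIONS --safe #-}
module Submission where

-- Call a vertex white if it lies in a nontrivial component of G - N[X], and blue if it is not white
-- but has a white neighbour; Move and Step describe the game in terms of the set W of white vertices.
-- A potential of at most 5n drops by 22 in each round (a move of Dominator and one of Staller), so
-- the game lasts at most 5n/11 moves. White vertices weigh 5 in both phases.
--
-- Phase 1: blue vertices weigh 3, and every move of Staller gains 5. If two adjacent white vertices
-- both have two white neighbours, acyclicity gives a white v all of whose white neighbours but one,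
-- u, are pendant, and Dominator gains 5 + 5 + 5 + 2 = 17 by playing u. If not, the components of W
-- are stars, and a centre with three leaves gives him 20. What is left is a set W whose components
-- are all K₂ or P₃.
--
-- Phase 2: a blue x weighs min(3, s(x)), where each white neighbour of x contributes to s(x)
-- 1 if it lies in a K₂ and 2 if it lies in a P₃; s(x) is the number of walks of length 3 from x
-- whose later vertices are white. As long as there is a P₃ Dominator plays the centre of one, if
-- possible of one with a blue neighbour x, s(x) ≤ 4. He gains 15 + 1 and Staller at least 6, or 15
-- and Staller 7. When only K₂'s are left, Dominator plays a blue vertex meeting two of them (gaining
-- 20), and if none exists each K₂ has blue neighbours of its own, so every move gains 11.

open import Defs
open import Data.Bool using (Bool; true; false; _∧_; _∨_; not; if_then_else_)
import Data.Bool.Properties as Bool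
open import Data.Bool.ListAction using (any)
open import Data.Fin using (Fin; zero; suc; _≟_; toℕ)
open import Data.Fin.Properties using (any?; injective⇒≤; suc-injective)
open import Data.Fin.Subset using (Subset; ⊥; ∣_∣; inside)
open import Data.Fin.Subset.Properties using (∣⊥∣≡0)
open import Data.List using (List; []; _∷_; [_]; _++_; length; map; take; lookup; allFin)
open import Data.List.Membership.Propositional using (_∈_; lose)
import Data.List.Membership.DecPropositional as DecMembership
import Data.List.Membership.Propositional.Properties as ∈
open import Data.List.Properties using (foldr-preservesᵇ; foldr-preservesᵒ)
open import Data.List.Relation.Unary.All using (All; []; _∷_)
import Data.List.Relation.Unary.All as All
import Data.List.Relation.Unary.All.Properties as All
open import Data.List.Relation.Unary.AllPairs using (AllPairs; []; _∷_)
open import Data.List.Relation.Unary.Any using (Any; here; there; index)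
import Data.List.Relation.Unary.Any as Any
import Data.List.Relation.Unary.Any.Properties as Any
open import Data.List.Relation.Unary.Linked using (Linked; [-]; _∷_)
open import Data.List.Relation.Unary.Unique.Propositional using (Unique)
import Data.List.Relation.Unary.Unique.Propositional.Properties as Unique
open import Data.Nat using (ℕ; zero; suc; _+_; _*_; _⊓_; _⊔_; _≤_; _<_; z≤n; s≤s; _≤?_; +-0-rawMonoid)
open import Data.Nat.Induction using (<-rec)
open import Data.Nat.ListAction using () renaming (sum to listSum)
open import Data.Nat.Properties hiding (_≟_; suc-injective)
open import Data.Product using (∃; ∃₂; _×_; _,_; proj₁; proj₂)
open import Data.Sum using (_⊎_; inj₁; inj₂)
open import Data.Vec using ([]; _∷_; _[_]≔_) renaming (lookup to _!_)
open import Data.Vec.Functional using (updateAt)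
open import Data.Vec.Functional.Properties using (updateAt-updates; updateAt-minimal)
open import Data.Vec.Properties using (lookup∘update; lookup∘update′)
open import Algebra.Definitions.RawMonoid +-0-rawMonoid using (sum)
open import Function using (_∘_; const; Equivalence)
open import Relation.Nullary using (¬_; Dec; yes; no; contradiction; _×-dec_; _⊎-dec_; ¬?)
open import Relation.Nullary.Decidable using (⌊_⌋; map′; decidable-stable)
open import Relation.Binary.Construct.Closure.ReflexiveTransitive using (Star; ε; _◅_)
open import Relation.Binary.PropositionalEquality
  using (_≡_; _≢_; refl; sym; trans; cong; cong₂; subst; module ≡-Reasoning)

-- Finite sums

sum-mono : ∀ {n} {f g : Fin n → ℕ} → (∀ i → f i ≤ g i) → sum f ≤ sum g
sum-mono {zero}  f≤g = z≤n
sum-mono {suc n} f≤g = +-mono-≤ (f≤g zero) (sum-mono (f≤g ∘ suc))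

sum-drop : ∀ {n} {f g : Fin n → ℕ} → (∀ i → f i ≤ g i) →
           ∀ i {d} → f i + d ≤ g i → sum f + d ≤ sum g
sum-drop {suc n} {f} {g} f≤g zero {d} drop = begin
  f zero + sum (f ∘ suc) + d   ≡⟨ +-assoc (f zero) _ d ⟩
  f zero + (sum (f ∘ suc) + d) ≡⟨ cong (f zero +_) (+-comm _ d) ⟩
  f zero + (d + sum (f ∘ suc)) ≡⟨ +-assoc (f zero) d _ ⟨
  f zero + d + sum (f ∘ suc)   ≤⟨ +-mono-≤ drop (sum-mono (f≤g ∘ suc)) ⟩
  g zero + sum (g ∘ suc)       ∎
  where open ≤-Reasoning
sum-drop {suc n} {f} {g} f≤g (suc i) {d} drop = begin
  f zero + sum (f ∘ suc) + d   ≡⟨ +-assoc (f zero) _ d ⟩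
  f zero + (sum (f ∘ suc) + d) ≤⟨ +-mono-≤ (f≤g zero) (sum-drop (f≤g ∘ suc) i drop) ⟩
  g zero + sum (g ∘ suc)       ∎
  where open ≤-Reasoning

DistinctKeys : ∀ {n} → List (Fin n × ℕ) → Set
DistinctKeys = AllPairs λ p q → proj₁ p ≢ proj₁ q

-- Raising `f` to `g` at the first key turns its drop into an increase of the sum; as the keys are
-- distinct, the other drops are unaffected. This adds up the gains of a move over the vertices
-- named in `ds`.
sum-drops : ∀ {n} {f g : Fin n → ℕ} → (∀ i → f i ≤ g i) →
            ∀ {ds} → DistinctKeys ds → All (λ (i , d) → f i + d ≤ g i) ds →
            sum f + listSum (map proj₂ ds) ≤ sum g
sum-drops f≤g [] [] = ≤-trans (≤-reflexive (+-identityʳ _)) (sum-mono f≤g)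
sum-drops {f = f} {g} f≤g {(i , d) ∷ ds} (i≢ ∷ distinct) (drop ∷ drops) = begin
  sum f + (d + rest)  ≡⟨ +-assoc (sum f) d rest ⟨
  sum f + d + rest    ≤⟨ +-monoˡ-≤ rest (sum-drop f≤h i (subst (f i + d ≤_) (sym h-at-i) drop)) ⟩
  sum h + rest        ≤⟨ sum-drops h≤g distinct (All.zipWith drop-h (i≢ , drops)) ⟩
  sum g               ∎
  where
  open ≤-Reasoning
  rest = listSum (map proj₂ ds)
  h = updateAt f i (const (g i))
  h-at-i : h i ≡ g i
  h-at-i = updateAt-updates i f
  h-off-i : ∀ {j} → i ≢ j → h j ≡ f j
  h-off-i i≢j = updateAt-minimal _ i f (i≢j ∘ sym)
  f≤h : ∀ j → f j ≤ h j
  f≤h j with i ≟ j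
  ... | yes refl = subst (f i ≤_) (sym h-at-i) (f≤g i)
  ... | no i≢j   = ≤-reflexive (sym (h-off-i i≢j))
  h≤g : ∀ j → h j ≤ g j
  h≤g j with i ≟ j
  ... | yes refl = ≤-reflexive h-at-i
  ... | no i≢j   = subst (_≤ g j) (sym (h-off-i i≢j)) (f≤g j)
  drop-h : ∀ {p} → i ≢ proj₁ p × f (proj₁ p) + proj₂ p ≤ g (proj₁ p) →
           h (proj₁ p) + proj₂ p ≤ g (proj₁ p)
  drop-h {j , e} (i≢j , drop) = subst (λ m → m + e ≤ g j) (sym (h-off-i i≢j)) drop

term≤sum : ∀ {n} (f : Fin n → ℕ) i → f i ≤ sum f
term≤sum f i = m+n≤o⇒n≤o _ (sum-drop {f = const 0} {f} (λ _ → z≤n) i ≤-refl)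

sum-zero : ∀ {n} {f : Fin n → ℕ} → (∀ i → f i ≡ 0) → sum f ≡ 0
sum-zero {zero}  f≡0 = refl
sum-zero {suc n} f≡0 = cong₂ _+_ (f≡0 zero) (sum-zero (f≡0 ∘ suc))

sum-bounded : ∀ {n m} (f : Fin n → ℕ) → (∀ i → f i ≤ m) → sum f ≤ m * n
sum-bounded {zero}      f f≤ = z≤n
sum-bounded {suc n} {m} f f≤ = ≤-trans (+-mono-≤ (f≤ zero) (sum-bounded (f ∘ suc) (f≤ ∘ suc)))
                                       (≤-reflexive (sym (*-suc m n)))

sum≤1 : ∀ {n} (f : Fin n → ℕ) → (∀ i → f i ≤ 1) →
        (∀ i j → 1 ≤ f i → 1 ≤ f j → i ≡ j) → sum f ≤ 1
sum≤1 {zero}  f f≤1 unique = z≤n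
sum≤1 {suc n} f f≤1 unique with f zero in eq
... | zero  = sum≤1 (f ∘ suc) (f≤1 ∘ suc)
                λ i j p q → suc-injective (unique (suc i) (suc j) p q)
... | suc k = ≤-trans (≤-reflexive (cong (suc k +_) (sum-zero rest≡0)))
                (≤-trans (≤-reflexive (+-identityʳ _)) (subst (_≤ 1) eq (f≤1 zero)))
  where
  rest≡0 : ∀ i → f (suc i) ≡ 0
  rest≡0 i with f (suc i) in eq′
  ... | zero  = refl
  ... | suc _ with unique zero (suc i) (subst (1 ≤_) (sym eq) (s≤s z≤n)) (subst (1 ≤_) (sym eq′) (s≤s z≤n))
  ...   | ()

-- Non-backtracking walks in acyclic graphs

lookup-injective : ∀ {A : Set} {xs : List A} → Unique xs →
                   ∀ {i j} → lookup xs i ≡ lookup xs j → i ≡ j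
lookup-injective (_ ∷ _) {zero}  {zero}  _  = refl
lookup-injective (x∉ ∷ _) {zero}  {suc j} eq = contradiction eq (All.lookup x∉ (∈.∈-lookup j))
lookup-injective (x∉ ∷ _) {suc i} {zero}  eq = contradiction (sym eq) (All.lookup x∉ (∈.∈-lookup i))
lookup-injective (_ ∷ u) {suc i} {suc j} eq = cong suc (lookup-injective u eq)

length-unique : ∀ {n} {xs : List (Fin n)} → Unique xs → length xs ≤ n
length-unique u = injective⇒≤ (lookup-injective u)

module _ {n : ℕ} (G : Graph n) where
  open Graph G using (irrefl) renaming (sym to adj-sym)
  open DecMembership (_≟_ {n}) using (_∈?_)

  ~-sym : ∀ {u v} → Adj G u v → Adj G v u
  ~-sym {u} {v} u~v = trans (adj-sym v u) u~v

  ~⇒≢ : ∀ {u v} → Adj G u v → u ≢ v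
  ~⇒≢ {u} u~u refl with trans (sym u~u) (irrefl u)
  ... | ()

  -- Closes the cycle in `no-endless-walk`: the walk is cut just after `t`, from which `x` is
  -- reached by one edge.
  linked-upto : ∀ {p t x xs} (t∈xs : t ∈ xs) → Linked (Adj G) (p ∷ xs) → Adj G t x →
                Linked (Adj G) (p ∷ take (suc (toℕ (index t∈xs))) xs ++ [ x ])
  linked-upto (here refl)  (e ∷ _)  t~x = e ∷ t~x ∷ [-]
  linked-upto (there t∈xs) (e ∷ es) t~x = e ∷ linked-upto t∈xs es t~x

  length-upto : ∀ {t : Fin n} {xs} (t∈xs : t ∈ xs) → 1 ≤ length (take (suc (toℕ (index t∈xs))) xs)
  length-upto (here _)  = s≤s z≤n
  length-upto (there _) = s≤s z≤n

  module _ (acyclic : ¬ HasCycle G) where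

    no-triangle : ∀ {u v w} → Adj G u v → Adj G v w → ¬ Adj G w u
    no-triangle {u} {v} {w} u~v v~w w~u = acyclic
      (u , v ∷ w ∷ [] , s≤s (s≤s z≤n) ,
       (~⇒≢ u~v ∷ ~⇒≢ (~-sym w~u) ∷ []) ∷ (~⇒≢ v~w ∷ []) ∷ [] ∷ [] ,
       u~v ∷ v~w ∷ w~u ∷ [-])

    -- Following `continue` never turns back, so in a finite graph the walk meets itself, and the
    -- part between the two visits is a cycle.
    no-endless-walk : {E : Fin n → Fin n → Set} → (∀ {u v} → E u v → Adj G u v) →
                      (∀ {u v} → E u v → ∃ λ t → E v t × t ≢ u) → ∀ {u v} → ¬ E u v
    no-endless-walk {E} E⇒~ continue {u} {v} e =
      -- The walk is kept with its newest vertex first; `k` bounds the number of further steps, as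
      -- distinct vertices number at most `n`.
      extend n v u [] e (m≤m+n n 2) ((~⇒≢ (~-sym (E⇒~ e)) ∷ []) ∷ [] ∷ []) (~-sym (E⇒~ e) ∷ [-])
      where
      extend : ∀ k v u rest → E u v → n ≤ k + length (v ∷ u ∷ rest) → Unique (v ∷ u ∷ rest) →
               ¬ Linked (Adj G) (v ∷ u ∷ rest)
      extend k v u rest e long distinct linked with continue e
      ... | t , e′ , t≢u with t ∈? rest
      -- `t` is neither `v` nor `u`, so a repetition lies in `rest` and the cycle has at least three
      -- vertices.
      ...   | yes t∈rest = acyclic (v , u ∷ take m rest , s≤s (length-upto t∈rest) ,
                             Unique.take⁺ (suc (suc m)) distinct ,
                             closed linked)
        where
        m = suc (toℕ (index t∈rest))
        closed : Linked (Adj G) (v ∷ u ∷ rest) → Linked (Adj G) (v ∷ u ∷ take m rest ++ [ v ])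
        closed (v~u ∷ path) = v~u ∷ linked-upto t∈rest path (~-sym (E⇒~ e′))
      ...   | no t∉rest with k
      ...     | zero  = contradiction (≤-trans (s≤s long) (length-unique longer)) 1+n≰n
        where
        longer : Unique (t ∷ v ∷ u ∷ rest)
        longer = (~⇒≢ (~-sym (E⇒~ e′)) ∷ t≢u ∷ All.¬Any⇒All¬ rest t∉rest) ∷ distinct
      ...     | suc k = extend k t v (u ∷ rest) e′ (≤-trans long (≤-reflexive (sym (+-suc k _))))
                          ((~⇒≢ (~-sym (E⇒~ e′)) ∷ t≢u ∷ All.¬Any⇒All¬ rest t∉rest) ∷ distinct)
                          (~-sym (E⇒~ e′) ∷ linked)

-- White sets, moves and steps

_∋_ _∌_ : ∀ {n} → (Fin n → Bool) → Fin n → Set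
W ∋ v = W v ≡ true
W ∌ v = W v ≡ false

_⊑_ : ∀ {n} → (Fin n → Bool) → (Fin n → Bool) → Set
W′ ⊑ W = ∀ {v} → W′ ∋ v → W ∋ v

clash : ∀ {b : Bool} {A : Set} → b ≡ true → b ≡ false → A
clash refl ()

∋∌⇒≢ : ∀ {n} (W : Fin n → Bool) {u v} → W ∋ u → W ∌ v → u ≢ v
∋∌⇒≢ W u∈W v∉W refl = clash u∈W v∉W

module _ {n : ℕ} (G : Graph n) where
  open Graph G using (adj)

  record Nbr (W : Fin n → Bool) (v u : Fin n) : Set where
    constructor nbr
    field
      edge  : Adj G v u
      white : W ∋ u

  Branching : (Fin n → Bool) → Fin n → Set
  Branching W v = ∃₂ λ a b → a ≢ b × Nbr W v a × Nbr W v b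

  Nbr? : ∀ W v u → Dec (Nbr W v u)
  Nbr? W v u = map′ (λ (e , w) → nbr e w) (λ (nbr e w) → e , w)
    ((adj v u Bool.≟ true) ×-dec (W u Bool.≟ true))

  Branching? : ∀ W v → Dec (Branching W v)
  Branching? W v = any? λ a → any? λ b → ¬? (a ≟ b) ×-dec Nbr? W v a ×-dec Nbr? W v b

  nbr-unique : ∀ {W v} → ¬ Branching W v → ∀ {a b} → Nbr W v a → Nbr W v b → a ≡ b
  nbr-unique ¬br {a} {b} p q with a ≟ b
  ... | yes a≡b = a≡b
  ... | no a≢b  = contradiction (a , b , a≢b , p , q) ¬br

  Live : (Fin n → Bool) → Set
  Live W = ∀ {v} → W ∋ v → ∃ (Nbr W v)

  record Dead (W : Fin n → Bool) (v : Fin n) : Set where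
    constructor dead
    field
      outside  : W ∌ v
      isolated : ∀ {u} → ¬ Nbr W v u

  Dead-⊑ : ∀ {W W′ v} → W′ ⊑ W → Dead W v → Dead W′ v
  Dead-⊑ W′⊑W (dead v∉W none) =
    dead (Bool.¬-not λ v∈W′ → clash (W′⊑W v∈W′) v∉W) (λ (nbr e u∈W′) → none (nbr e (W′⊑W u∈W′)))

  -- Without `v₀` the vertex `v` has no white neighbour left, and a live set contains no such
  -- vertex. In `W` the vertex `v` may be white or blue.
  pendant-dead : ∀ {W W′} → W′ ⊑ W → Live W′ → ∀ {v v₀} →
                 (∀ {u} → Nbr W v u → u ≡ v₀) → W′ ∌ v₀ → Dead W′ v
  pendant-dead {W} {W′} W′⊑W live {v} only v₀∉W′ =
    dead (Bool.¬-not λ v∈W′ → none (proj₂ (live v∈W′))) none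
    where
    none : ∀ {u} → ¬ Nbr W′ v u
    none (nbr e u∈W′) = ∋∌⇒≢ W′ u∈W′ v₀∉W′ (only (nbr e (W′⊑W u∈W′)))

  Hits : Fin n → Fin n → Set
  Hits y v = y ≡ v ⊎ Adj G y v

  Move : (Fin n → Bool) → Fin n → Set
  Move W y = ∃ λ v → W ∋ v × Hits y v

  -- Describes the new white set only from above: the game leaves the largest live subset of `W`
  -- outside N[y], and any smaller live one is allowed too. This is harmless because potentials are
  -- monotone in the set.
  record Step (W : Fin n → Bool) (y : Fin n) (W′ : Fin n → Bool) : Set where
    field
      sub   : W′ ⊑ W
      hit   : ∀ {v} → Hits y v → W′ ∌ v
      live′ : Live W′

    played-dead : Dead W′ y
    played-dead = dead (hit (inj₁ refl)) λ (nbr e u∈W′) → clash u∈W′ (hit (inj₂ e))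

  -- Counting walks

  -- Walks of length `k` from `v` whose later vertices lie in `W`. Inside a K₂ one walk of length 2
  -- starts at each vertex, inside a P₃ two do, at the centre as at the ends; so length 3 from a
  -- blue vertex gives the contributions 1 and 2 to s.
  walks : (Fin n → Bool) → ℕ → Fin n → ℕ
  walks W zero    v = 1
  walks W (suc k) v = sum λ u → if adj v u ∧ W u then walks W k u else 0

  private
    term : (Fin n → Bool) → ℕ → Fin n → Fin n → ℕ
    term W k v u = if adj v u ∧ W u then walks W k u else 0

    term-nbr : ∀ {W} k {v u} → Nbr W v u → term W k v u ≡ walks W k u
    term-nbr k (nbr e u∈W) rewrite e | u∈W = refl

    term-pos : ∀ {W} k {v u} → 1 ≤ term W k v u → Nbr W v u
    term-pos {W} k {v} {u} p with adj v u in e | W u in w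
    ... | true | true = nbr e w

    term-≤ : ∀ {W} k {v u m} → (Nbr W v u → walks W k u ≤ m) → term W k v u ≤ m
    term-≤ {W} k {v} {u} p with adj v u in e | W u in w
    ... | true  | true  = p (nbr e w)
    ... | true  | false = z≤n
    ... | false | _     = z≤n

    walks-mono : ∀ {W W′} → W′ ⊑ W → ∀ k v → walks W′ k v ≤ walks W k v
    term-mono  : ∀ {W W′} → W′ ⊑ W → ∀ k v u → term W′ k v u ≤ term W k v u
    walks-mono W′⊑W zero    v = ≤-refl
    walks-mono W′⊑W (suc k) v = sum-mono (term-mono W′⊑W k v)
    term-mono W′⊑W k v u = term-≤ k λ (nbr e u∈W′) →
      ≤-trans (walks-mono W′⊑W k u) (≤-reflexive (sym (term-nbr k (nbr e (W′⊑W u∈W′)))))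

  walks-step : ∀ {W} k {v u} → Nbr W v u → walks W k u ≤ walks W (suc k) v
  walks-step {W} k {v} {u} p = subst (_≤ walks W (suc k) v) (term-nbr k p) (term≤sum (term W k v) u)

  walks-branch : ∀ {W} k {v a b} → a ≢ b → Nbr W v a → Nbr W v b →
                 walks W k a + walks W k b ≤ walks W (suc k) v
  walks-branch {W} k {v} {a} {b} a≢b p q = begin
    walks W k a + walks W k b       ≡⟨ cong (walks W k a +_) (+-identityʳ _) ⟨
    walks W k a + (walks W k b + 0) ≤⟨ m+n≤o⇒n≤o (sum {n} (const 0))
                                         (sum-drops (λ _ → z≤n) ((a≢b ∷ []) ∷ [] ∷ []) (at p ∷ at q ∷ [])) ⟩
    walks W (suc k) v               ∎
    where
    open ≤-Reasoning
    at : ∀ {u} → Nbr W v u → walks W k u ≤ term W k v u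
    at r = ≤-reflexive (sym (term-nbr k r))

  walks-drop : ∀ {W W′} → W′ ⊑ W → ∀ k {v u} → Nbr W v u → W′ ∌ u →
               walks W′ (suc k) v + walks W k u ≤ walks W (suc k) v
  walks-drop {W} {W′} W′⊑W k {v} {u} p u∉W′ = sum-drop (term-mono W′⊑W k v) u
    (≤-trans (+-monoˡ-≤ _ (term-≤ k {m = 0} (λ (nbr _ u∈W′) → clash u∈W′ u∉W′)))
             (≤-reflexive (sym (term-nbr k p))))

  walks-none : ∀ {W} k {v} → (∀ {u} → ¬ Nbr W v u) → walks W (suc k) v ≡ 0
  walks-none {W} k {v} none = sum-zero λ u → n≤0⇒n≡0 (term-≤ {W} k {v} {u} λ p → contradiction p none)

  walks≤1 : ∀ {W} k {v} → (∀ {a b} → Nbr W v a → Nbr W v b → a ≡ b) →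
            (∀ {u} → Nbr W v u → walks W k u ≤ 1) → walks W (suc k) v ≤ 1
  walks≤1 k unique ≤1 = sum≤1 _ (λ u → term-≤ k ≤1)
    λ a b p q → unique (term-pos k p) (term-pos k q)

  walks-live : ∀ {W} → Live W → ∀ k {v} → ∃ (Nbr W v) → 1 ≤ walks W k v
  walks-live live zero    _             = ≤-refl
  walks-live live (suc k) (u , p@(nbr _ u∈W)) = ≤-trans (walks-live live k (live u∈W)) (walks-step k p)

  -- Potentials

  -- (m , k) is (3 , 0) in phase 1 and (1 , 2) in phase 2.
  module Potential (m k : ℕ) where

    -- For (3 , 0) the minimum is 3 as soon as `v` has a white neighbour; for (1 , 2) it is s(v)
    -- capped at 3.
    weight : (Fin n → Bool) → Fin n → ℕ
    weight W v = if W v then 5 else 3 ⊓ (m * walks W (suc k) v)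

    potential : (Fin n → Bool) → ℕ
    potential W = sum (weight W)

    weight-white : ∀ W {v} → W ∋ v → weight W v ≡ 5
    weight-white W v∈W rewrite v∈W = refl

    weight-blue : ∀ W {v} → W ∌ v → weight W v ≡ 3 ⊓ (m * walks W (suc k) v)
    weight-blue W v∉W rewrite v∉W = refl

    weight-blue≤3 : ∀ W {v} → W ∌ v → weight W v ≤ 3
    weight-blue≤3 W v∉W = ≤-trans (≤-reflexive (weight-blue W v∉W)) (m⊓n≤m 3 _)

    weight≤5 : ∀ W v → weight W v ≤ 5
    weight≤5 W v with W v
    ... | true  = ≤-refl
    ... | false = ≤-trans (m⊓n≤m 3 _) (s≤s (s≤s (s≤s z≤n)))

    weight-dead : ∀ {W v} → Dead W v → weight W v ≡ 0
    weight-dead {W} {v} (dead v∉W none) = begin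
      weight W v                      ≡⟨ weight-blue W v∉W ⟩
      3 ⊓ (m * walks W (suc k) v)     ≡⟨ cong (λ s → 3 ⊓ (m * s)) (walks-none k none) ⟩
      3 ⊓ (m * 0)                     ≡⟨ cong (3 ⊓_) (*-zeroʳ m) ⟩
      0                               ∎
      where open ≡-Reasoning

    weight-mono : ∀ {W W′} → W′ ⊑ W → ∀ v → weight W′ v ≤ weight W v
    weight-mono {W} {W′} W′⊑W v with W v in eq
    ... | true  = weight≤5 W′ v
    ... | false = ≤-trans (≤-reflexive (weight-blue W′ (Bool.¬-not λ v∈W′ → clash (W′⊑W v∈W′) eq)))
                    (⊓-monoʳ-≤ 3 (*-monoʳ-≤ m (walks-mono W′⊑W (suc k) v)))

    potential-drops : ∀ {W W′ ds} → W′ ⊑ W → DistinctKeys ds →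
                      All (λ (v , d) → weight W′ v + d ≤ weight W v) ds →
                      potential W′ + listSum (map proj₂ ds) ≤ potential W
    potential-drops W′⊑W = sum-drops (weight-mono W′⊑W)

    drop-dead : ∀ W {W′ v d} → Dead W′ v → d ≤ weight W v → weight W′ v + d ≤ weight W v
    drop-dead W {d = d} v-dead d≤ = ≤-trans (≤-reflexive (cong (_+ d) (weight-dead v-dead))) d≤

    drop-white : ∀ W {W′ v} → W ∋ v → Dead W′ v → weight W′ v + 5 ≤ weight W v
    drop-white W v∈W v-dead = drop-dead W v-dead (≤-reflexive (sym (weight-white W v∈W)))

    drop-dominated : ∀ W W′ {v} → W ∋ v → W′ ∌ v → weight W′ v + 2 ≤ weight W v
    drop-dominated W W′ v∈W v∉W′ =
      ≤-trans (+-monoˡ-≤ 2 (weight-blue≤3 W′ v∉W′)) (≤-reflexive (sym (weight-white W v∈W)))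

-- Good rounds and small components

module _ {n : ℕ} (G : Graph n) where

  -- A round in which the potential pays 11 for each of the two moves. Nothing is asked if Staller
  -- has no reply; `potential≥11` pays for such a last move.
  Good : ℕ → ℕ → (Fin n → Bool) → Set
  Good m k W = ∃ λ x → Move G W x ×
    (∀ {W′ W″ y} → Step G W x W′ → Move G W′ y → Step G W′ y W″ →
      Potential.potential G m k W″ + 22 ≤ Potential.potential G m k W)

  -- For a live `W` this means that all components are K₂ or P₃. Phrased by forbidden patterns, it
  -- passes to subsets, so phase 2 is never left.
  record Small (W : Fin n → Bool) : Set where
    field
      thin   : ∀ {u v} → W ∋ v → Nbr G W v u → Branching G W v → ¬ Branching G W u
      narrow : ∀ {v a b c} → W ∋ v → a ≢ b → Nbr G W v a → Nbr G W v b → Nbr G W v c → c ≡ a ⊎ c ≡ b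

  Branching-⊑ : ∀ {W W′ v} → W′ ⊑ W → Branching G W′ v → Branching G W v
  Branching-⊑ W′⊑W (a , b , a≢b , nbr ea wa , nbr eb wb) =
    a , b , a≢b , nbr ea (W′⊑W wa) , nbr eb (W′⊑W wb)

  Small-⊑ : ∀ {W W′} → W′ ⊑ W → Small W → Small W′
  Small-⊑ W′⊑W small = record
    { thin   = λ v∈W′ (nbr e w) p q → thin (W′⊑W v∈W′) (nbr e (W′⊑W w)) (Branching-⊑ W′⊑W p) (Branching-⊑ W′⊑W q)
    ; narrow = λ v∈W′ a≢b (nbr ea wa) (nbr eb wb) (nbr ec wc) →
        narrow (W′⊑W v∈W′) a≢b (nbr ea (W′⊑W wa)) (nbr eb (W′⊑W wb)) (nbr ec (W′⊑W wc))
    }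
    where open Small small

  -- Phase 1: reduction to components K₂ and P₃

  module Phase₁ (acyclic : ¬ HasCycle G) where
    open Potential G 3 0

    -- A white `y` dies, worth 5; a blue `y` dies, worth 3, and takes 2 from a white neighbour.
    staller-drop : ∀ {W y W′} → Live G W → Move G W y → Step G W y W′ → potential W′ + 5 ≤ potential W
    staller-drop {W} {y} {W′} live (v , v∈W , hit-v) step with W y in eq
    ... | true  = potential-drops sub ([] ∷ []) (drop-white W eq played-dead ∷ [])
      where open Step step
    ... | false with hit-v
    ...   | inj₁ refl = clash v∈W eq
    ...   | inj₂ y~v  = potential-drops sub ((~⇒≢ G y~v ∷ []) ∷ [] ∷ [])
                          (drop-dead W played-dead y-weighs-3 ∷ drop-dominated W W′ v∈W (hit (inj₂ y~v)) ∷ [])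
      where
      open Step step
      y-weighs-3 : 3 ≤ weight W y
      y-weighs-3 = ≤-trans (⊓-glb ≤-refl (*-monoʳ-≤ 3 (walks-live G live 1 (v , nbr y~v v∈W))))
                           (≤-reflexive (sym (weight-blue W eq)))

    good : ∀ {W x} → Move G W x → (∀ {W′} → Step G W x W′ → potential W′ + 17 ≤ potential W) → Good 3 0 W
    good {W} {x} move drop = x , move , λ {W′} {W″} step move′ step′ → (begin
      potential W″ + 22       ≡⟨ +-assoc (potential W″) 5 17 ⟨
      potential W″ + 5 + 17   ≤⟨ +-monoˡ-≤ 17 (staller-drop (Step.live′ step) move′ step′) ⟩
      potential W′ + 17       ≤⟨ drop step ⟩
      potential W             ∎)
      where open ≤-Reasoning

    -- These pairs, symmetric in `u` and `v`, are the edges of a forest; `good-end` plays next to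
    -- one of its leaves.
    Inner : (Fin n → Bool) → Fin n → Fin n → Set
    Inner W u v = (Nbr G W u v × Branching G W v) × (Nbr G W v u × Branching G W u)

    Inner? : ∀ W u v → Dec (Inner W u v)
    Inner? W u v = (Nbr? G W u v ×-dec Branching? G W v) ×-dec (Nbr? G W v u ×-dec Branching? G W u)

    other-nbr : ∀ {W v} → Branching G W v → ∀ u → ∃ λ t → t ≢ u × Nbr G W v t
    other-nbr (a , b , a≢b , p , q) u with a ≟ u
    ... | no a≢u   = a , a≢u , p
    ... | yes refl = b , a≢b ∘ sym , q

    -- v is an end of the tree of inner vertices and u its only neighbour there.
    good-end : ∀ {W} → Live G W → ∀ {u v} → Inner W u v → (∀ {t} → Inner W v t → t ≡ u) → Good 3 0 W
    good-end {W} live {u} {v} ((nbr u~v v∈W , v-br) , (nbr v~u u∈W , u-br)) end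
      with other-nbr v-br u | other-nbr u-br v
    ... | a , a≢u , a-nbr@(nbr v~a a∈W) | b , b≢v , nbr u~b b∈W =
      good (u , u∈W , inj₁ refl) λ {W′} step →
        let open Step step
            v∉W′ = hit (inj₂ u~v)
            -- A branching `t` would make the edge from `v` to `t` inner, and `end` would identify
            -- `t` with `u`.
            pendant-of-v : ∀ {t} → Nbr G W v t → t ≢ u → ∀ {s} → Nbr G W t s → s ≡ v
            pendant-of-v = λ { {t} v-t@(nbr v~t _) t≢u t-s →
              nbr-unique G (λ t-br → t≢u (end ((v-t , t-br) , (nbr (~-sym G v~t) v∈W , v-br))))
                t-s (nbr (~-sym G v~t) v∈W) }
            a-only = pendant-of-v a-nbr a≢u
            v-isolated : ∀ {t} → ¬ Nbr G W′ v t
            v-isolated = λ { {t} (nbr v~t t∈W′) →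
              let t≢u = ∋∌⇒≢ W′ t∈W′ (hit (inj₁ refl)) in
              clash t∈W′ (Dead.outside (pendant-dead G sub live′ (pendant-of-v (nbr v~t (sub t∈W′)) t≢u) v∉W′)) }
        in potential-drops sub
             ( (~⇒≢ G u~v ∷ a≢u ∘ sym ∷ ~⇒≢ G u~b ∷ [])
             ∷ (~⇒≢ G v~a ∷ b≢v ∘ sym ∷ [])
             -- If `a` were `b`, then `u` would be a second white neighbour of the pendant `a`.
             ∷ ((λ { refl → ~⇒≢ G v~u (sym (a-only (nbr (~-sym G u~b) u∈W))) }) ∷ [])
             ∷ [] ∷ [])
             ( drop-white W u∈W played-dead
             ∷ drop-white W v∈W (dead v∉W′ v-isolated)
             ∷ drop-white W a∈W (pendant-dead G sub live′ a-only v∉W′)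
             ∷ drop-dominated W W′ b∈W (hit (inj₂ u~b)) ∷ [])

    good-star : ∀ {W} → Live G W → (∀ {u v} → ¬ Inner W u v) → ∀ {c a b d} → W ∋ c →
                Nbr G W c a → Nbr G W c b → Nbr G W c d → a ≢ b → a ≢ d → b ≢ d → Good 3 0 W
    good-star {W} live no-inner {c} {a} {b} c∈W p q r a≢b a≢d b≢d =
      good (c , c∈W , inj₁ refl) λ {W′} step →
        let open Step step
            -- `t` has no white neighbour besides `c`, or the edge between them would be inner.
            drop-leaf : ∀ {t} → Nbr G W c t → weight W′ t + 5 ≤ weight W t
            drop-leaf = λ { {t} c-t@(nbr c~t t∈W) →
              let t-c = nbr (~-sym G c~t) c∈W in
              drop-white W t∈W (pendant-dead G sub live′
                (λ s → nbr-unique G (λ t-br → no-inner ((c-t , t-br) , (t-c , (a , b , a≢b , p , q)))) s t-c)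
                (hit (inj₁ refl))) }
        -- The star yields 20, of which 17 are claimed.
        in ≤-trans (+-monoʳ-≤ (potential W′) (m≤m+n 17 3)) (potential-drops sub
             ( (~⇒≢ G (Nbr.edge p) ∷ ~⇒≢ G (Nbr.edge q) ∷ ~⇒≢ G (Nbr.edge r) ∷ [])
             ∷ (a≢b ∷ a≢d ∷ []) ∷ (b≢d ∷ []) ∷ [] ∷ [])
             (drop-white W c∈W played-dead ∷ drop-leaf p ∷ drop-leaf q ∷ drop-leaf r ∷ []))

    End? : ∀ W u v → Dec (Inner W u v × ¬ ∃ λ t → Inner W v t × t ≢ u)
    End? W u v = Inner? W u v ×-dec ¬? (any? λ t → Inner? W v t ×-dec ¬? (t ≟ u))

    -- Without an end every inner edge is followed by another one that does not turn back.
    no-end⇒no-inner : ∀ {W} → ¬ (∃₂ λ u v → Inner W u v × ¬ ∃ λ t → Inner W v t × t ≢ u) →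
                      ∀ {u v} → ¬ Inner W u v
    no-end⇒no-inner {W} no-end = no-endless-walk G acyclic {E = Inner W} (Nbr.edge ∘ proj₁ ∘ proj₁)
      λ {u} {v} inner → decidable-stable (any? λ t → Inner? W v t ×-dec ¬? (t ≟ u))
                                         λ none → no-end (u , v , inner , none)

    good-or-small : ∀ {W} → Live G W → Good 3 0 W ⊎ Small W
    good-or-small {W} live with any? (λ u → any? λ v → End? W u v)
    ... | yes (u , v , inner , end) =
      inj₁ (good-end live inner λ {t} inner′ → decidable-stable (t ≟ u) λ t≢u → end (t , inner′ , t≢u))
    ... | no no-end with any? (λ c → any? λ a → any? λ b → any? λ d →
            (W c Bool.≟ true) ×-dec (Nbr? G W c a ×-dec Nbr? G W c b ×-dec Nbr? G W c d) ×-dec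
            ¬? (a ≟ b) ×-dec ¬? (a ≟ d) ×-dec ¬? (b ≟ d))
    ...   | yes (c , a , b , d , c∈W , (p , q , r) , a≢b , a≢d , b≢d) =
      inj₁ (good-star live no-inner c∈W p q r a≢b a≢d b≢d)
      where no-inner = no-end⇒no-inner no-end
    ...   | no no-star = inj₂ record
      { thin   = λ {u} {v} v∈W v-u v-br u-br →
          no-inner ((v-u , u-br) , (nbr (~-sym G (Nbr.edge v-u)) v∈W , v-br))
      ; narrow = λ {v} {a} {b} {c} v∈W a≢b p q r → decidable-stable ((c ≟ a) ⊎-dec (c ≟ b)) λ c∉ab →
          no-star (v , a , b , c , v∈W , (p , q , r) , a≢b , c∉ab ∘ inj₁ ∘ sym , c∉ab ∘ inj₂ ∘ sym)
      }
      where no-inner = no-end⇒no-inner no-end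

-- Leaving an edge of a connected graph

third-element : ∀ {n} → 3 ≤ n → (a b : Fin n) → ∃ λ z → z ≢ a × z ≢ b
third-element (s≤s (s≤s (s≤s _))) zero          zero          = suc zero , (λ ()) , λ ()
third-element (s≤s (s≤s (s≤s _))) zero          (suc zero)    = suc (suc zero) , (λ ()) , λ ()
third-element (s≤s (s≤s (s≤s _))) zero          (suc (suc _)) = suc zero , (λ ()) , λ ()
third-element (s≤s (s≤s (s≤s _))) (suc zero)    zero          = suc (suc zero) , (λ ()) , λ ()
third-element (s≤s (s≤s (s≤s _))) (suc (suc _)) zero          = suc zero , (λ ()) , λ ()
third-element (s≤s (s≤s (s≤s _))) (suc _)       (suc _)       = zero , (λ ()) , λ ()

module _ {n : ℕ} (G : Graph n) where

  module Spanning (3≤n : 3 ≤ n) (connected : Connected G) where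

    -- As n ≥ 3, some `z` lies outside the pair; a path from `a` to `z` leaves the pair at the
    -- required vertex.
    edge-exit : ∀ a b → ∃ λ x → x ≢ a × x ≢ b × (Adj G a x ⊎ Adj G b x)
    edge-exit a b with third-element 3≤n a b
    ... | z , z≢a , z≢b = exit (connected a z) (inj₁ refl)
      where
      exit : ∀ {p} → Star (Adj G) p z → p ≡ a ⊎ p ≡ b → ∃ λ x → x ≢ a × x ≢ b × (Adj G a x ⊎ Adj G b x)
      exit ε (inj₁ refl) = contradiction refl z≢a
      exit ε (inj₂ refl) = contradiction refl z≢b
      exit (_◅_ {j = q} p~q path) p∈ab with q ≟ a | q ≟ b
      ... | yes q≡a | _       = exit path (inj₁ q≡a)
      ... | no _    | yes q≡b = exit path (inj₂ q≡b)
      ... | no q≢a  | no q≢b  with p∈ab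
      ...   | inj₁ refl = q , q≢a , q≢b , inj₁ p~q
      ...   | inj₂ refl = q , q≢a , q≢b , inj₂ p~q

    -- A white edge weighs 10, and `edge-exit` provides a third vertex of weight at least 1. This
    -- pays for a move of Dominator that ends the game.
    potential≥11 : ∀ {m k} → 1 ≤ m → ∀ {W v} → Live G W → W ∋ v → 11 ≤ Potential.potential G m k W
    potential≥11 {m} {k} 1≤m {W} {v} live v∈W with live v∈W
    ... | u , nbr v~u u∈W with edge-exit v u
    -- Compared with the empty set, in which all vertices are dead, the three weights are lost in
    -- full.
    ...   | x , x≢v , x≢u , near = m+n≤o⇒n≤o (potential (const false))
      (potential-drops (λ ()) ((~⇒≢ G v~u ∷ x≢v ∘ sym ∷ []) ∷ (x≢u ∘ sym ∷ []) ∷ [] ∷ [])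
        (drop-white W v∈W none ∷ drop-white W u∈W none ∷ drop-dead W none x-weighs ∷ []))
      where
      open Potential G m k
      none : ∀ {z} → Dead G (const false) z
      none = dead refl λ ()
      x-nbr : Adj G v x ⊎ Adj G u x → ∃ (Nbr G W x)
      x-nbr (inj₁ v~x) = v , nbr (~-sym G v~x) v∈W
      x-nbr (inj₂ u~x) = u , nbr (~-sym G u~x) u∈W
      x-weighs : 1 ≤ weight W x
      x-weighs with W x
      ... | true  = s≤s z≤n
      ... | false = ⊓-glb (s≤s z≤n) (*-mono-≤ 1≤m (walks-live G live (suc k) (x-nbr near)))

  -- Phase 2: playing on components K₂ and P₃

  module Phase₂ where
    open Potential G 1 2

    weight-blue≥ : ∀ W {v d} → W ∌ v → d ≤ 3 → d ≤ walks G W 3 v → d ≤ weight W v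
    weight-blue≥ W {v} {d} v∉W d≤3 d≤ =
      ≤-trans (⊓-glb d≤3 (≤-trans d≤ (≤-reflexive (sym (*-identityˡ _))))) (≤-reflexive (sym (weight-blue W v∉W)))

    weight-blue≤ : ∀ W {v} → W ∌ v → weight W v ≤ walks G W 3 v
    weight-blue≤ W {v} v∉W =
      ≤-trans (≤-reflexive (weight-blue W v∉W)) (≤-trans (m⊓n≤n 3 _) (≤-reflexive (*-identityˡ _)))

    branching-walks : ∀ {W} → Live G W → ∀ k {c} → Branching G W c → 2 ≤ walks G W (suc k) c
    branching-walks live k (a , b , a≢b , p@(nbr _ a∈W) , q@(nbr _ b∈W)) =
      ≤-trans (+-mono-≤ (walks-live G live k (live a∈W)) (walks-live G live k (live b∈W)))
              (walks-branch G k a≢b p q)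

    -- If t keeps a neighbour in W′, then t was an end of a P₃, which leaves a K₂.
    weight-dominated≤1 : ∀ {W W′ t} → W′ ⊑ W → Live G W′ → Small G W → W ∋ t → W′ ∌ t → weight W′ t ≤ 1
    weight-dominated≤1 {W} {W′} {t} W′⊑W live′ small t∈W t∉W′ = ≤-trans (weight-blue≤ W′ t∉W′)
      (walks≤1 G 2 centre-unique λ c-nbr →
        walks≤1 G 1 (end-unique c-nbr) λ b-nbr →
          walks≤1 G 0 (nbr-unique G (thin (W′⊑W (Nbr.white c-nbr)) (up b-nbr) (centre c-nbr) ∘ Branching-⊑ G W′⊑W))
            λ _ → ≤-refl)
      where
      open Small small
      up : ∀ {v u} → Nbr G W′ v u → Nbr G W v u
      up (nbr e w) = nbr e (W′⊑W w)
      back : ∀ {c} → Nbr G W′ t c → Nbr G W c t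
      back (nbr e _) = nbr (~-sym G e) t∈W
      centre : ∀ {c} → Nbr G W′ t c → Branching G W c
      centre c-nbr@(nbr _ c∈W′) with live′ c∈W′
      ... | b , b-nbr@(nbr _ b∈W′) = t , b , ∋∌⇒≢ W′ b∈W′ t∉W′ ∘ sym , back c-nbr , up b-nbr
      centre-unique : ∀ {c d} → Nbr G W′ t c → Nbr G W′ t d → c ≡ d
      centre-unique {c} {d} p q = decidable-stable (c ≟ d) λ c≢d →
        thin t∈W (up p) (c , d , c≢d , up p , up q) (centre p)
      end-unique : ∀ {c} → Nbr G W′ t c → ∀ {a b} → Nbr G W′ c a → Nbr G W′ c b → a ≡ b
      end-unique p@(nbr _ c∈W′) {a} {b} q@(nbr _ a∈W′) r@(nbr _ b∈W′)
        with narrow (W′⊑W c∈W′) (∋∌⇒≢ W′ a∈W′ t∉W′ ∘ sym) (back p) (up q) (up r)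
      ... | inj₁ b≡t = contradiction b≡t (∋∌⇒≢ W′ b∈W′ t∉W′)
      ... | inj₂ b≡a = sym b≡a

    -- For a white `v` and a centre `c`, membership in the P₃ around `c`.
    Near : Fin n → Fin n → Set
    Near v c = v ≡ c ⊎ Adj G v c

    near-walks : ∀ {W} → Live G W → ∀ {v c} → W ∋ c → Branching G W c → Near v c → 2 ≤ walks G W 2 v
    near-walks live c∈W c-br (inj₁ refl) = branching-walks live 1 c-br
    near-walks live c∈W c-br (inj₂ v~c)  = ≤-trans (branching-walks live 0 c-br) (walks-step G 1 (nbr v~c c∈W))

    LightBlue : (Fin n → Bool) → Fin n → Fin n → Fin n → Set
    LightBlue W c x v = W ∌ x × Nbr G W x v × Near v c × walks G W 3 x ≤ 4

    -- The alternative to a light blue vertex, stated for a `y` that meets a P₃ at an end `t` with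
    -- centre `u`; it makes `y` weigh the full 3.
    Heavy : (Fin n → Bool) → Set
    Heavy W = ∀ {y t u} → W ∌ y → Nbr G W y t → Nbr G W t u → Branching G W u → 5 ≤ walks G W 3 y

    -- Playing `c` kills its P₃, worth 15. The missing 7 come from the reply alone, or 6 from the
    -- reply and 1 from the light blue vertex. Drops are measured from `W` to `W″`, so a blue reply
    -- counts with its weight before the round.
    good-centre : ∀ {W} → Live G W → Small G W → ∀ {c} → W ∋ c → Branching G W c →
                  (∃₂ λ x v → LightBlue W c x v) ⊎ Heavy W →
                  Good G 1 2 W
    good-centre {W} live small {c} c∈W c-br@(a , b , a≢b , p@(nbr c~a a∈W) , q@(nbr c~b b∈W)) light-or-heavy =
      c , (c , c∈W , inj₁ refl) , reply
      where
      open Small small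
      reply : ∀ {W′ W″ y} → Step G W c W′ → Move G W′ y → Step G W′ y W″ → potential W″ + 22 ≤ potential W
      reply {W′} {W″} {y} step (t , t∈W′ , hit-t) step′ = outcome hit-t
        where
        open Step step
        open Step step′ using () renaming (sub to sub′; hit to hit′; live′ to live″; played-dead to y-dead)
        W″⊑W : W″ ⊑ W
        W″⊑W v∈W″ = sub (sub′ v∈W″)

        leaf-dead : ∀ {l} → Nbr G W c l → Dead G W′ l
        leaf-dead l-nbr@(nbr c~l _) =
          let c-nbr = nbr (~-sym G c~l) c∈W in
          pendant-dead G sub live′
            (λ s-nbr → nbr-unique G (thin c∈W l-nbr c-br) s-nbr c-nbr) (hit (inj₁ refl))

        hit-near : ∀ {v} → Near v c → W′ ∌ v
        hit-near (inj₁ refl) = hit (inj₁ refl)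
        hit-near (inj₂ v~c)  = hit (inj₂ (~-sym G v~c))

        -- The three vertices of the P₃ are already counted, so every further key must differ from
        -- them.
        Fresh : Fin n → Set
        Fresh v = c ≢ v × a ≢ v × b ≢ v
        away : ∀ {v} → (∀ {z} → W ∋ z → Dead G W′ z → z ≢ v) → Fresh v
        away ≢v = ≢v c∈W played-dead , ≢v a∈W (leaf-dead p) , ≢v b∈W (leaf-dead q)
        fresh-white : ∀ {v} → W′ ∋ v → Fresh v
        fresh-white v∈W′ = away λ _ z-dead → ∋∌⇒≢ W′ v∈W′ (Dead.outside z-dead) ∘ sym
        fresh-blue : ∀ {v} → W ∌ v → Fresh v
        fresh-blue v∉W = away λ z∈W _ → ∋∌⇒≢ W z∈W v∉W
        fresh-beside : ∀ {v u} → Nbr G W′ v u → Fresh v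
        fresh-beside u-nbr = away λ { _ z-dead refl → Dead.isolated z-dead u-nbr }

        finish : ∀ {ds} → All (λ (v , _) → Fresh v) ds → DistinctKeys ds →
                 All (λ (v , d) → weight W″ v + d ≤ weight W v) ds → 7 ≤ listSum (map proj₂ ds) →
                 potential W″ + 22 ≤ potential W
        finish fresh distinct drops 7≤ = ≤-trans (+-monoʳ-≤ (potential W″) (+-monoʳ-≤ 15 7≤))
          (potential-drops W″⊑W
            ( (~⇒≢ G c~a ∷ ~⇒≢ G c~b ∷ All.map proj₁ fresh)
            ∷ (a≢b ∷ All.map (proj₁ ∘ proj₂) fresh)
            ∷ All.map (proj₂ ∘ proj₂) fresh
            ∷ distinct)
            ( drop-white W c∈W (Dead-⊑ G sub′ played-dead)
            ∷ drop-white W a∈W (Dead-⊑ G sub′ (leaf-dead p))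
            ∷ drop-white W b∈W (Dead-⊑ G sub′ (leaf-dead q))
            ∷ drops))

        module BlueReply (y∉W : W ∌ y) (y~t : Adj G y t) where
          t∈W = sub t∈W′
          t∉W″ = hit′ (inj₂ y~t)
          t-nbr : Nbr G W y t
          t-nbr = nbr y~t t∈W
          drop-t : weight W″ t + 4 ≤ weight W t
          drop-t = ≤-trans (+-monoˡ-≤ 4 (weight-dominated≤1 W″⊑W live″ small t∈W t∉W″))
                           (≤-reflexive (sym (weight-white W t∈W)))
          drop-y : ∀ {d} → d ≤ 3 → d ≤ walks G W 3 y → weight W″ y + d ≤ weight W y
          drop-y d≤3 d≤ = drop-dead W y-dead (weight-blue≥ W y∉W d≤3 d≤)
          y≢t = ~⇒≢ G y~t

          y-heavy : 3 ≤ walks G W 3 y → potential W″ + 22 ≤ potential W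
          y-heavy 3≤ = finish (fresh-blue y∉W ∷ fresh-white t∈W′ ∷ []) ((y≢t ∷ []) ∷ [] ∷ [])
                         (drop-y ≤-refl 3≤ ∷ drop-t ∷ []) ≤-refl

          blue-outcome : potential W″ + 22 ≤ potential W
          blue-outcome with live′ t∈W′
          ... | u , nbr t~u u∈W′ with W″ u in eq
          -- 1 + 4 + 2 from `y`, `t` and `u`.
          ...   | false = finish (fresh-blue y∉W ∷ fresh-white t∈W′ ∷ fresh-white u∈W′ ∷ [])
                            ((y≢t ∷ ∋∌⇒≢ W (sub u∈W′) y∉W ∘ sym ∷ []) ∷ (~⇒≢ G t~u ∷ []) ∷ [] ∷ [])
                            (drop-y (s≤s z≤n) (walks-live G live 3 (t , t-nbr)) ∷ drop-t
                              ∷ drop-dominated W W″ (sub u∈W′) eq ∷ [])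
                            ≤-refl
          -- `u` stays white and keeps another white neighbour, so `t` is an end of a P₃ with centre
          -- `u`, and `y` weighs at least 2.
          ...   | true = by-blue light-or-heavy
            where
            u-br : Branching G W u
            u-br with live″ eq
            ... | s , nbr u~s s∈W″ = t , s , ∋∌⇒≢ W″ s∈W″ t∉W″ ∘ sym , nbr (~-sym G t~u) t∈W , nbr u~s (W″⊑W s∈W″)
            2≤t : 2 ≤ walks G W 2 t
            2≤t = near-walks live (sub u∈W′) u-br (inj₂ t~u)
            by-blue : (∃₂ λ x v → LightBlue W c x v) ⊎ Heavy W → potential W″ + 22 ≤ potential W
            by-blue (inj₂ heavy) = y-heavy (≤-trans (m≤m+n 3 2) (heavy y∉W t-nbr (nbr t~u (sub u∈W′)) u-br))
            by-blue (inj₁ (x , v , x∉W , v-nbr , near , ≤4)) with x ≟ y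
            -- `y` meets both `v` and `t`, with two walks or more through each, so it weighs 3.
            ... | yes refl = y-heavy (≤-trans (m≤m+n 3 1) (≤-trans (+-mono-≤ (near-walks live c∈W c-br near) 2≤t) (walks-branch G 2 v≢t v-nbr t-nbr)))
              where
              v≢t = ∋∌⇒≢ W′ t∈W′ (hit-near near) ∘ sym
            ... | no x≢y = finish (fresh-blue y∉W ∷ fresh-white t∈W′ ∷ fresh-blue x∉W ∷ [])
                             ((y≢t ∷ x≢y ∘ sym ∷ []) ∷ (∋∌⇒≢ W t∈W x∉W ∷ []) ∷ [] ∷ [])
                             (drop-y (s≤s (s≤s z≤n)) (≤-trans 2≤t (walks-step G 2 t-nbr)) ∷ drop-t ∷ drop-x ∷ [])
                             ≤-refl
              where
              v∉W″ = Bool.¬-not λ v∈W″ → clash (sub′ v∈W″) (hit-near near)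
              x∉W″ = Bool.¬-not λ x∈W″ → clash (W″⊑W x∈W″) x∉W
              -- Losing `v` costs `x` at least two walks; from at most 4 this leaves at most 2, so
              -- the weight falls in spite of the cap at 3.
              lost : walks G W″ 3 x + 2 ≤ walks G W 3 x
              lost = ≤-trans (+-monoʳ-≤ _ (near-walks live c∈W c-br near)) (walks-drop G W″⊑W 2 v-nbr v∉W″)
              drop-x : weight W″ x + 1 ≤ weight W x
              drop-x = ≤-trans (+-monoˡ-≤ 1 (weight-blue≤ W″ x∉W″))
                (weight-blue≥ W x∉W
                  (+-cancelʳ-≤ 1 _ 3 (≤-trans (≤-reflexive (+-assoc (walks G W″ 3 x) 1 1)) (≤-trans lost ≤4)))
                  (≤-trans (+-monoʳ-≤ (walks G W″ 3 x) (s≤s z≤n)) lost))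

        outcome : Hits G y t → potential W″ + 22 ≤ potential W
        outcome hit-t with W′ y in y-white′ | W y in y-white
        ... | true | _ with live′ y-white′
        ...   | u , nbr y~u u∈W′ =
          finish (fresh-white y-white′ ∷ fresh-white u∈W′ ∷ []) ((~⇒≢ G y~u ∷ []) ∷ [] ∷ [])
            (drop-white W (sub y-white′) y-dead ∷ drop-dominated W W″ (sub u∈W′) (hit′ (inj₂ y~u)) ∷ []) ≤-refl
        outcome (inj₁ refl) | false | _     = clash t∈W′ y-white′
        -- `Step` lets `W′` lose more than the game forces, so `y` may be white in `W` but not in
        -- `W′`.
        outcome (inj₂ y~t)  | false | true  =
          finish (fresh-beside (nbr y~t t∈W′) ∷ fresh-white t∈W′ ∷ []) ((~⇒≢ G y~t ∷ []) ∷ [] ∷ [])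
            (drop-white W y-white y-dead ∷ drop-dominated W W″ (sub t∈W′) (hit′ (inj₂ y~t)) ∷ []) ≤-refl
        outcome (inj₂ y~t)  | false | false = BlueReply.blue-outcome y-white y~t

    -- `u` and `v` are each other's only white neighbour, so losing one loses both.
    partner-dead : ∀ {W W′} → W′ ⊑ W → Live G W′ → ∀ {u v} → ¬ Branching G W u → ¬ Branching G W v →
                   Nbr G W v u → Nbr G W u v → W′ ∌ v → Dead G W′ u × Dead G W′ v
    partner-dead {W} {W′} W′⊑W live′ u-end v-end v-u u-v v∉W′ = u-dead , v-dead
      where
      u-dead = pendant-dead G W′⊑W live′ (λ s → nbr-unique G u-end s u-v) v∉W′
      v-dead = pendant-dead G W′⊑W live′ (λ s → nbr-unique G v-end s v-u) (Dead.outside u-dead)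

    -- Acyclicity places `v₁` and `v₂` in different K₂'s, and playing `x` kills both for 20. Any
    -- reply dominates a white vertex, for 2 more.
    good-shared : ¬ HasCycle G → ∀ {W} → Live G W → (∀ {v} → W ∋ v → ¬ Branching G W v) →
                  ∀ {x} → W ∌ x → Branching G W x → Good G 1 2 W
    good-shared acyclic {W} live ends {x} x∉W (v₁ , v₂ , v₁≢v₂ , nbr x~v₁ v₁∈W , nbr x~v₂ v₂∈W)
      with live v₁∈W | live v₂∈W
    ... | u₁ , e₁@(nbr v₁~u₁ u₁∈W) | u₂ , e₂@(nbr v₂~u₂ u₂∈W) =
      x , (v₁ , v₁∈W , inj₂ x~v₁) , λ {W′} {W″} step move step′ → (begin
        potential W″ + 22      ≡⟨ +-assoc (potential W″) 2 20 ⟨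
        potential W″ + 2 + 20  ≤⟨ +-monoˡ-≤ 20 (reply move step′) ⟩
        potential W′ + 20      ≤⟨ drop step ⟩
        potential W            ∎)
      where
      open ≤-Reasoning
      reply : ∀ {W′ W″ y} → Move G W′ y → Step G W′ y W″ → potential W″ + 2 ≤ potential W′
      reply {W′} {W″} (t , t∈W′ , hit-t) step =
        potential-drops (Step.sub step) ([] ∷ []) (drop-dominated W′ W″ t∈W′ (Step.hit step hit-t) ∷ [])
      e₁′ = nbr (~-sym G v₁~u₁) v₁∈W
      e₂′ = nbr (~-sym G v₂~u₂) v₂∈W
      v₁≁v₂ : ¬ Adj G v₁ v₂
      v₁≁v₂ v₁~v₂ = no-triangle G acyclic x~v₁ v₁~v₂ (~-sym G x~v₂)
      v₁≢u₂ : v₁ ≢ u₂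
      v₁≢u₂ refl = v₁≁v₂ (~-sym G v₂~u₂)
      v₂≢u₁ : v₂ ≢ u₁
      v₂≢u₁ refl = v₁≁v₂ v₁~u₁
      u₁≢u₂ : u₁ ≢ u₂
      u₁≢u₂ refl = v₁≢v₂ (nbr-unique G (ends u₁∈W) e₁′ e₂′)
      drop : ∀ {W′} → Step G W x W′ → potential W′ + 20 ≤ potential W
      drop step = potential-drops sub
        ( (v₁≢v₂ ∷ ~⇒≢ G v₁~u₁ ∷ v₁≢u₂ ∷ []) ∷ (v₂≢u₁ ∷ ~⇒≢ G v₂~u₂ ∷ []) ∷ (u₁≢u₂ ∷ []) ∷ [] ∷ [])
        ( drop-white W v₁∈W (proj₂ dead₁) ∷ drop-white W v₂∈W (proj₂ dead₂)
        ∷ drop-white W u₁∈W (proj₁ dead₁) ∷ drop-white W u₂∈W (proj₁ dead₂) ∷ [])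
        where
        open Step step
        dead₁ = partner-dead sub live′ (ends u₁∈W) (ends v₁∈W) e₁ e₁′ (hit (inj₂ x~v₁))
        dead₂ = partner-dead sub live′ (ends u₂∈W) (ends v₂∈W) e₂ e₂′ (hit (inj₂ x~v₂))

    module _ (acyclic : ¬ HasCycle G) (3≤n : 3 ≤ n) (connected : Connected G) where
      open Spanning 3≤n connected

      -- By `ends` the vertex `x` from `edge-exit` is blue with a single white neighbour, so it dies
      -- together with the K₂: 5 + 5 + 1. This serves the moves of both players.
      component-drop : ∀ {W W′} → Live G W → (∀ v → ¬ Branching G W v) → W′ ⊑ W → Live G W′ →
                       ∀ {v} → W ∋ v → W′ ∌ v → potential W′ + 11 ≤ potential W
      component-drop {W} {W′} live ends W′⊑W live′ {v} v∈W v∉W′ with live v∈W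
      ... | u , v-u@(nbr v~u u∈W) with edge-exit v u
      ...   | x , x≢v , x≢u , near = potential-drops W′⊑W
        ((~⇒≢ G v~u ∷ x≢v ∘ sym ∷ []) ∷ (x≢u ∘ sym ∷ []) ∷ [] ∷ [])
        (drop-white W v∈W v-dead ∷ drop-white W u∈W u-dead ∷ drop-dead W (x-dead near) (x-weighs near) ∷ [])
        where
        u-v = nbr (~-sym G v~u) v∈W
        uv-dead = partner-dead W′⊑W live′ (ends u) (ends v) v-u u-v v∉W′
        u-dead = proj₁ uv-dead
        v-dead = proj₂ uv-dead
        x-dead : Adj G v x ⊎ Adj G u x → Dead G W′ x
        x-dead (inj₁ v~x) = pendant-dead G W′⊑W live′ (λ s → nbr-unique G (ends x) s (nbr (~-sym G v~x) v∈W)) v∉W′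
        x-dead (inj₂ u~x) =
          pendant-dead G W′⊑W live′ (λ s → nbr-unique G (ends x) s (nbr (~-sym G u~x) u∈W)) (Dead.outside u-dead)
        x∉W : Adj G v x ⊎ Adj G u x → W ∌ x
        x∉W (inj₁ v~x) = Bool.¬-not λ x∈W → x≢u (nbr-unique G (ends v) (nbr v~x x∈W) v-u)
        x∉W (inj₂ u~x) = Bool.¬-not λ x∈W → x≢v (nbr-unique G (ends u) (nbr u~x x∈W) u-v)
        x-nbr : Adj G v x ⊎ Adj G u x → ∃ (Nbr G W x)
        x-nbr (inj₁ v~x) = v , nbr (~-sym G v~x) v∈W
        x-nbr (inj₂ u~x) = u , nbr (~-sym G u~x) u∈W
        x-weighs : Adj G v x ⊎ Adj G u x → 1 ≤ weight W x
        x-weighs near = weight-blue≥ W (x∉W near) (s≤s z≤n) (walks-live G live 3 (x-nbr near))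

      good-isolated : ∀ {W} → Live G W → (∀ v → ¬ Branching G W v) → ∀ {v} → W ∋ v → Good G 1 2 W
      good-isolated {W} live ends {v} v∈W = v , (v , v∈W , inj₁ refl) ,
        λ { {W′} {W″} step (t , t∈W′ , hit-t) step′ →
          let open Step step
              open Step step′ renaming (sub to sub′; hit to hit′; live′ to live″) in
          begin
          potential W″ + 22       ≡⟨ +-assoc (potential W″) 11 11 ⟨
          potential W″ + 11 + 11  ≤⟨ +-monoˡ-≤ 11
            (component-drop live′ (λ u → ends u ∘ Branching-⊑ G sub) sub′ live″ t∈W′ (hit′ hit-t)) ⟩
          potential W′ + 11       ≤⟨ component-drop live ends sub live′ v∈W (hit (inj₁ refl)) ⟩
          potential W             ∎ }
        where open ≤-Reasoning

      Near? : ∀ v c → Dec (Near v c)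
      Near? v c = (v ≟ c) ⊎-dec (Graph.adj G v c Bool.≟ true)

      good-small : ∀ {W} → Live G W → Small G W → ∀ {v} → W ∋ v → Good G 1 2 W
      good-small {W} live small v∈W
        with any? (λ c → (W c Bool.≟ true) ×-dec Branching? G W c ×-dec any? λ x → any? λ v →
               (W x Bool.≟ false) ×-dec Nbr? G W x v ×-dec Near? v c ×-dec (walks G W 3 x ≤? 4))
      ... | yes (c , c∈W , c-br , light) = good-centre live small c∈W c-br (inj₁ light)
      ... | no no-light with any? (λ c → (W c Bool.≟ true) ×-dec Branching? G W c)
      ...   | yes (c , c∈W , c-br) = good-centre live small c∈W c-br (inj₂ λ {y} {t} {u} y∉W y-t (nbr t~u u∈W) u-br →
        ≰⇒> λ ≤4 → no-light (u , u∈W , u-br , y , t , y∉W , y-t , inj₂ t~u , ≤4))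
      -- Only K₂'s are left, so a branching vertex, if there is one, is blue.
      ...   | no no-centre with any? (λ x → Branching? G W x)
      ...     | no no-branching = good-isolated live (λ v br → no-branching (v , br)) v∈W
      ...     | yes (x , x-br) = good-shared acyclic live (λ v∈W v-br → no-centre (_ , v∈W , v-br))
                                   (Bool.¬-not λ x∈W → no-centre (x , x∈W , x-br)) x-br

-- White sets of positions of the game

any-elim : ∀ {n} (p : Fin n → Bool) → any p (allFin n) ≡ true → ∃ λ v → p v ≡ true
any-elim p eq with Any.satisfied (Any.any⁻ p (allFin _) (Equivalence.from Bool.T-≡ eq))
... | v , pv = v , Equivalence.to Bool.T-≡ pv

any-intro : ∀ {n} (p : Fin n → Bool) v → p v ≡ true → any p (allFin n) ≡ true
any-intro p v pv = Equivalence.to Bool.T-≡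
  (Any.any⁺ p (lose (∈.∈-allFin v) (Equivalence.from Bool.T-≡ pv)))

∧-elim : ∀ {a b} → a ∧ b ≡ true → a ≡ true × b ≡ true
∧-elim {true} {true} _ = refl , refl

∧-intro : ∀ {a b} → a ≡ true → b ≡ true → a ∧ b ≡ true
∧-intro refl refl = refl

not-elim : ∀ {a} → not a ≡ true → a ≡ false
not-elim {false} _ = refl

not-intro : ∀ {a} → a ≡ false → not a ≡ true
not-intro refl = refl

∣update∣≤ : ∀ {n} (X : Subset n) y → ∣ X [ y ]≔ inside ∣ ≤ suc ∣ X ∣
∣update∣≤ (true  ∷ X) zero    = n≤1+n _
∣update∣≤ (false ∷ X) zero    = ≤-refl
∣update∣≤ (true  ∷ X) (suc y) = s≤s (∣update∣≤ X y)
∣update∣≤ (false ∷ X) (suc y) = ∣update∣≤ X y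

module _ {n : ℕ} (G : Graph n) where
  open Graph G using (adj)

  white : Subset n → Fin n → Bool
  white = inNontrivialComponent G

  Hits-elim : ∀ {u v} → ⌊ u ≟ v ⌋ ∨ adj u v ≡ true → Hits G u v
  Hits-elim {u} {v} eq with u ≟ v
  ... | yes u≡v = inj₁ u≡v
  ... | no _    = inj₂ eq

  Hits-intro : ∀ {u v} → Hits G u v → ⌊ u ≟ v ⌋ ∨ adj u v ≡ true
  Hits-intro {u} {v} hit with u ≟ v | hit
  ... | yes _   | _        = refl
  ... | no u≢v  | inj₁ u≡v = contradiction u≡v u≢v
  ... | no _    | inj₂ u~v = u~v

  closed-intro : ∀ X {u v} → X ! u ≡ true → Hits G u v → inClosedNbhd G X v ≡ true
  closed-intro X u∈X hit = any-intro (λ w → (X ! w) ∧ (⌊ w ≟ _ ⌋ ∨ adj w _)) _ (∧-intro u∈X (Hits-intro hit))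

  closed-update : ∀ X y v → inClosedNbhd G X v ≡ true → inClosedNbhd G (X [ y ]≔ inside) v ≡ true
  closed-update X y v eq with any-elim _ eq
  ... | u , eq′ with ∧-elim eq′
  ...   | u∈X , hit = closed-intro (X [ y ]≔ inside) still-in (Hits-elim hit)
    where
    still-in : (X [ y ]≔ inside) ! u ≡ true
    still-in with u ≟ y
    ... | yes refl = lookup∘update u X inside
    ... | no u≢y   = trans (lookup∘update′ u≢y X inside) u∈X

  open-update : ∀ X y {v} → inClosedNbhd G (X [ y ]≔ inside) v ≡ false → inClosedNbhd G X v ≡ false
  open-update X y {v} v∉ = Bool.¬-not λ v∈ → clash (closed-update X y v v∈) v∉

  white-elim : ∀ X {v} → white X ∋ v →
               inClosedNbhd G X v ≡ false × ∃ λ u → Adj G v u × inClosedNbhd G X u ≡ false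
  white-elim X v∈ with ∧-elim v∈
  ... | v-open , has with any-elim _ has
  ...   | u , eq with ∧-elim eq
  ...     | v~u , u-open = not-elim v-open , u , v~u , not-elim u-open

  white-intro : ∀ X {v u} → inClosedNbhd G X v ≡ false → Adj G v u → inClosedNbhd G X u ≡ false → white X ∋ v
  white-intro X v-open v~u u-open =
    ∧-intro (not-intro v-open) (any-intro (λ w → adj _ w ∧ not (inClosedNbhd G X w)) _ (∧-intro v~u (not-intro u-open)))

  -- The neighbour that makes `v` white is white itself, with `v` as its witness.
  white-live : ∀ X → Live G (white X)
  white-live X v∈ with white-elim X v∈
  ... | v-open , u , v~u , u-open = u , nbr v~u (white-intro X u-open (~-sym G v~u) v-open)

  white-step : ∀ X y → Step G (white X) y (white (X [ y ]≔ inside))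
  white-step X y = record
    { sub   = λ v∈ → let (v-open , u , v~u , u-open) = white-elim X′ v∈ in
                white-intro X (open-update X y v-open) v~u (open-update X y u-open)
    ; hit   = λ hits → Bool.¬-not λ v∈ →
                clash (closed-intro X′ (lookup∘update y X inside) hits) (proj₁ (white-elim X′ v∈))
    ; live′ = white-live X′
    }
    where X′ = X [ y ]≔ inside

  playable-elim : ∀ X {y} → playable G X y ≡ true → Move G (white X) y
  playable-elim X eq with any-elim _ eq
  ... | v , eq′ with ∧-elim eq′
  ...   | hit , v∈ = v , v∈ , Hits-elim hit

  playable-intro : ∀ X {y} → Move G (white X) y → playable G X y ≡ true
  playable-intro X (v , v∈ , hit) = any-intro _ v (∧-intro (Hits-intro hit) v∈)

  ∈-moves⁻ : ∀ X {y} → y ∈ playableMoves G X → Move G (white X) y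
  ∈-moves⁻ X y∈ = playable-elim X (proj₂ (∈.∈-filter⁻ (λ x → playable G X x Bool.≟ true) {xs = allFin n} y∈))

  ∈-moves⁺ : ∀ X {y} → Move G (white X) y → y ∈ playableMoves G X
  ∈-moves⁺ X {y} move = ∈.∈-filter⁺ (λ x → playable G X x Bool.≟ true) (∈.∈-allFin y) (playable-intro X move)

  -- Bounds on minimax values

  value-over : ∀ f turn X → (∀ v → white X ∌ v) → gameValue G f turn X ≡ ∣ X ∣
  value-over zero    turn X none = refl
  value-over (suc f) turn X none with playableMoves G X in eq
  ... | []     = refl
  ... | x ∷ xs with ∈-moves⁻ X (subst (x ∈_) (sym eq) (here refl))
  ...   | v , v∈ , _ = clash v∈ (none v)

  value-dominator : ∀ f X {x} → Move G (white X) x →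
                    gameValue G (suc f) true X ≤ gameValue G f false (X [ x ]≔ inside)
  value-dominator f X {x} move with playableMoves G X | ∈-moves⁺ X move
  ... | z ∷ zs | x∈ = foldr-preservesᵒ (λ a b → λ { (inj₁ p) → ≤-trans (m⊓n≤m a b) p ; (inj₂ p) → ≤-trans (m⊓n≤n a b) p })
                        (next z) (map next zs) (locate x∈)
    where
    next : Fin n → ℕ
    next y = gameValue G f false (X [ y ]≔ inside)
    locate : x ∈ z ∷ zs → next z ≤ next x ⊎ Any (_≤ next x) (map next zs)
    locate (here refl) = inj₁ ≤-refl
    locate (there x∈)  = inj₂ (Any.map⁺ (Any.map (λ { refl → ≤-refl }) x∈))

  -- The first premise covers both the end of the game and exhausted fuel, the second one each
  -- reply.
  value-staller : ∀ f X {B} → 11 * ∣ X ∣ ≤ B →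
                  (∀ {g y} → g < f → Move G (white X) y → 11 * gameValue G g true (X [ y ]≔ inside) ≤ B) →
                  11 * gameValue G f false X ≤ B
  value-staller zero    X     now later = now
  value-staller (suc f) X {B} now later with playableMoves G X in eq
  ... | []     = now
  ... | z ∷ zs = foldr-preservesᵇ {P = λ m → 11 * m ≤ B} (λ {a} {b} → max {a} {b})
                   (All.head bounds) (All.map⁺ (All.tail bounds))
    where
    next : Fin n → ℕ
    next y = gameValue G f true (X [ y ]≔ inside)
    max : ∀ {a b} → 11 * a ≤ B → 11 * b ≤ B → 11 * (a ⊔ b) ≤ B
    max {a} {b} p q = ≤-trans (≤-reflexive (*-distribˡ-⊔ 11 a b)) (⊔-lub p q)
    bounds : All (λ y → 11 * next y ≤ B) (z ∷ zs)
    bounds = All.tabulate λ {y} y∈ → later ≤-refl (∈-moves⁻ X (subst (y ∈_) (sym eq) y∈))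

  -- Induction over the rounds

  module _ (3≤n : 3 ≤ n) (tree : IsTree G) where
    open Potential G using (potential)

    -- With Dominator to move, the potential divided by 11 bounds the number of further moves. The
    -- fuel `f` is arbitrary: running out of it returns the current size, just like the end of the
    -- game.
    Bound : ℕ → ℕ → ℕ → Subset n → Set
    Bound m k f X = 11 * gameValue G f true X ≤ 11 * ∣ X ∣ + potential m k (white X)

    bound-round : ∀ {m k} → 1 ≤ m → ∀ f X → (good : Good G m k (white X)) →
                  (∀ {g} y → g < suc f → Bound m k g ((X [ proj₁ good ]≔ inside) [ y ]≔ inside)) →
                  Bound m k (suc f) X
    bound-round {m} {k} 1≤m f X (x , move@(_ , v∈ , _) , reply) ih =
      ≤-trans (*-monoʳ-≤ 11 (value-dominator f X move))
        (value-staller f X₁ one-more λ {g} {y} g<f move′ →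
          two-more y (m<n⇒m<1+n g<f) (reply (white-step X x) move′ (white-step X₁ y)))
      where
      X₁ = X [ x ]≔ inside
      P = potential m k
      size₁ : 11 * ∣ X₁ ∣ ≤ 11 * ∣ X ∣ + 11
      size₁ = ≤-trans (*-monoʳ-≤ 11 (∣update∣≤ X x)) (≤-reflexive (trans (*-suc 11 ∣ X ∣) (+-comm 11 _)))
      one-more : 11 * ∣ X₁ ∣ ≤ 11 * ∣ X ∣ + P (white X)
      one-more = ≤-trans size₁
        (+-monoʳ-≤ (11 * ∣ X ∣) (Spanning.potential≥11 G 3≤n (proj₁ tree) {m} {k} 1≤m (white-live X) v∈))
      -- Two selected vertices cost 22, which is exactly the guaranteed drop.
      two-more : ∀ {g} y → g < suc f → P (white (X₁ [ y ]≔ inside)) + 22 ≤ P (white X) →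
                 11 * gameValue G g true (X₁ [ y ]≔ inside) ≤ 11 * ∣ X ∣ + P (white X)
      two-more {g} y g<1+f drop = begin
        11 * gameValue G g true X₂              ≤⟨ ih y g<1+f ⟩
        11 * ∣ X₂ ∣ + P (white X₂)              ≤⟨ +-monoˡ-≤ _ (*-monoʳ-≤ 11 (∣update∣≤ X₁ y)) ⟩
        11 * suc ∣ X₁ ∣ + P (white X₂)          ≡⟨ cong (_+ P (white X₂)) (*-suc 11 ∣ X₁ ∣) ⟩
        11 + 11 * ∣ X₁ ∣ + P (white X₂)         ≤⟨ +-monoˡ-≤ _ (+-monoʳ-≤ 11 size₁) ⟩
        11 + (11 * ∣ X ∣ + 11) + P (white X₂)   ≡⟨ cong (_+ P (white X₂))
                                                      (trans (+-comm 11 (11 * ∣ X ∣ + 11)) (+-assoc (11 * ∣ X ∣) 11 11)) ⟩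
        11 * ∣ X ∣ + 22 + P (white X₂)          ≡⟨ +-assoc (11 * ∣ X ∣) 22 _ ⟩
        11 * ∣ X ∣ + (22 + P (white X₂))        ≡⟨ cong (11 * ∣ X ∣ +_) (+-comm 22 _) ⟩
        11 * ∣ X ∣ + (P (white X₂) + 22)        ≤⟨ +-monoʳ-≤ (11 * ∣ X ∣) drop ⟩
        11 * ∣ X ∣ + P (white X)                ∎
        where
        open ≤-Reasoning
        X₂ = X₁ [ y ]≔ inside

    bound-over : ∀ {m k} f X → (∀ v → white X ∌ v) → Bound m k f X
    bound-over f X none = ≤-trans (≤-reflexive (cong (11 *_) (value-over f true X none))) (m≤m+n _ _)

    bound-small : ∀ f X → Small G (white X) → Bound 1 2 f X
    bound-small = <-rec _ λ
      { zero    rec X small → m≤m+n (11 * ∣ X ∣) _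
      ; (suc f) rec X small → play f rec X small (any? λ v → white X v Bool.≟ true) }
      where
      play : ∀ f → (∀ {g} → g < suc f → ∀ X → Small G (white X) → Bound 1 2 g X) →
             ∀ X → Small G (white X) → Dec (∃ λ v → white X ∋ v) → Bound 1 2 (suc f) X
      play f rec X small (no none)      = bound-over {1} {2} (suc f) X λ v → Bool.¬-not λ v∈ → none (v , v∈)
      play f rec X small (yes (v , v∈)) = bound-round {1} {2} ≤-refl f X good λ y g< →
        rec g< _ (Small-⊑ G
          (λ v∈ → Step.sub (white-step X (proj₁ good)) (Step.sub (white-step (X [ proj₁ good ]≔ inside) y) v∈)) small)
        where
        good = Phase₂.good-small G (proj₂ tree) 3≤n (proj₁ tree) (white-live X) small v∈

    -- A blue vertex with a white neighbour has the full weight 3 in phase 1, so changing phase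
    -- never raises the potential.
    potential₂≤potential₁ : ∀ W → potential 1 2 W ≤ potential 3 0 W
    potential₂≤potential₁ W = sum-mono weight≤
      where
      weight≤ : ∀ v → Potential.weight G 1 2 W v ≤ Potential.weight G 3 0 W v
      weight≤ v with W v
      ... | true  = ≤-refl
      ... | false with any? (Nbr? G W v)
      ...   | yes (u , u-nbr) = ≤-trans (m⊓n≤m 3 _) (⊓-glb ≤-refl (*-monoʳ-≤ 3 (walks-step G 0 u-nbr)))
      ...   | no none = ≤-trans (m⊓n≤n 3 _)
                          (≤-trans (≤-reflexive (cong (1 *_) (walks-none G 2 λ {u} p → none (u , p)))) z≤n)

    -- Rounds of phase 1 are played until the white set is small; from then on `bound-small` takes
    -- over.
    bound-any : ∀ f X → Bound 3 0 f X
    bound-any = <-rec _ λ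
      { zero    rec X → m≤m+n (11 * ∣ X ∣) _
      ; (suc f) rec X → play f rec X (Phase₁.good-or-small G (proj₂ tree) (white-live X)) }
      where
      play : ∀ f → (∀ {g} → g < suc f → ∀ X → Bound 3 0 g X) →
             ∀ X → Good G 3 0 (white X) ⊎ Small G (white X) → Bound 3 0 (suc f) X
      play f rec X (inj₁ good)  = bound-round {3} {0} (s≤s z≤n) f X good λ y g< → rec g< _
      play f rec X (inj₂ small) = ≤-trans (bound-small (suc f) X small)
                                    (+-monoʳ-≤ (11 * ∣ X ∣) (potential₂≤potential₁ (white X)))

theorem4p3 : (n : ℕ) → 3 ≤ n → (T : Graph n) → IsTree T → 11 * ιg T ≤ 5 * n
theorem4p3 n 3≤n T tree = begin
  11 * ιg T                  ≤⟨ bound-any T 3≤n tree n ⊥ ⟩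
  11 * ∣ ⊥ {n} ∣ + initial   ≡⟨ cong (λ s → 11 * s + initial) (∣⊥∣≡0 n) ⟩
  initial                    ≤⟨ sum-bounded _ (Potential.weight≤5 T 3 0 (white T ⊥)) ⟩
  5 * n                      ∎
  where
  open ≤-Reasoning
  initial = Potential.potential T 3 0 (white T ⊥)
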